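{- Suppose that $\mu>\lambda\ge\theta\ge\kappa$ are infinite cardinals. Then the following are equivalent: (A) There is a family $\mathcal{P}^*$ of $\mu$ subsets of $\lambda$, each of power $\le\kappa$ (none of whose subfamilies of size $\mu$ has a transversal, but) whose every subfamily of size $<\theta$ is discrete. (B) There is a regular ideal $J$ on $\kappa$, and a family $\mathcal{F}^*$ of $\mu$ many functions from $\kappa$ to $\lambda$ such that for every subfamily $\mathcal{F}$ of $\mathcal{F}^*$ with $|\mathcal{F}|<\theta$ there is a sequence $\langle s_f:f\in\mathcal{F}\rangle$ of sets in $J$ such that for all distinct $f,g\in\mathcal{F}$ \[ i\in\kappa\setminus(s_f\cap s_g)\implies f(i)\neq g(i), \] but there is no such sequence for any subfamily of $\mathcal{F}^*$ which has size $\mu$. Moreover, if $\mathcal{F}\subseteq\mathcal{F}^*$ is of size $\ge\lambda^+$, there is no sequence $\langle s_f:f\in\mathcal{F}\rangle$ of sets in $J$ such that for all distinct $f,g\in\mathcal{F}$ \[ i\in\kappa\setminus(s_f\cup s_g)\implies f(i)\neq g(i). \]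
   Context: A non-empty family $\mathcal{F}$ of non-empty sets is discrete iff there is a choice function $f$ on $\mathcal{F}$ (i.e. $f(F)\in F$ for all $F\in\mathcal{F}$) such that for all $F_0\ne F_1$ in $\mathcal{F}$, $f(F_0)\notin F_1$; such an $f$ is called a discretisation of $\mathcal{F}$. Discreteness is required of non-empty subfamilies. A transversal of a family of sets is a one-to-one choice function on it. Ideals are proper; an ideal $J$ on $\kappa$ is regular (in the standard sense) iff there are sets $A_\zeta\in J$ ($\zeta<\kappa$) such that each $i<\kappa$ belongs to $\kappa\setminus A_\zeta$ for only finitely many $\zeta<\kappa$. -}

module Defs where

open import Level using (Level; 0ℓ; _⊔_) renaming (suc to lsuc)
open import Data.Fin.Base using (Fin)
open import Data.Product.Base using (Σ; ∃; _×_; _,_; proj₁; proj₂)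
open import Function.Bundles using (Func; Injection; Bijection)
open import Function.Definitions using (Injective)
open import Induction.WellFounded using (WellFounded)
open import Relation.Binary.Bundles using (Setoid)
open import Relation.Binary.Core using (Rel)
open import Relation.Binary.Definitions using (_Respects_)
open import Relation.Binary.Structures using (IsStrictTotalOrder)
import Relation.Binary.Construct.On as On
open import Relation.Binary.PropositionalEquality using (_≡_; _≢_; setoid; _→-setoid_)
open import Relation.Nullary.Negation using (¬_)
open import Relation.Unary using (Pred; _∈_; _∉_; _⊆_; _∪_; _∩_; ∁; ∅; U)
open import Relation.Unary.Relation.Binary.Equality using (≐-setoid)

private
  variable
    a b c ℓ ℓ₁ ℓ₂ : Level

-- A set is rendered by a setoid: subsets of a type are compared by _≐_ and
-- functions pointwise, so that no extensionality axiom is needed.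

-- {x ∈ S : P x}; different proofs of P x do not give different elements.
infix 8 _↾_
_↾_ : (S : Setoid a ℓ) → Pred (Setoid.Carrier S) b → Setoid (a ⊔ b) ℓ
S ↾ P = On.setoid {B = ∃ P} S proj₁

infix 4 _≼_ _≺_ _≋_

_≼_ : Setoid a ℓ₁ → Setoid b ℓ₂ → Set _
S ≼ T = Injection S T

_≺_ : Setoid a ℓ₁ → Setoid b ℓ₂ → Set _
S ≺ T = S ≼ T × ¬ (T ≼ S)

_≋_ : Setoid a ℓ₁ → Setoid b ℓ₂ → Set _
S ≋ T = Bijection S T

Finite : Setoid a ℓ → Set _
Finite S = ∃ λ n → setoid (Fin n) ≋ S

-- Cardinals are initial ordinals: well-orders that do not inject into any of
-- their proper initial segments.
record Cardinal : Set₁ where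
  infix 4 _<_
  field
    Carrier            : Set
    _<_                : Rel Carrier 0ℓ
    isStrictTotalOrder : IsStrictTotalOrder _≡_ _<_
    wellFounded        : WellFounded _<_
    initial            : ∀ x → ¬ (setoid Carrier ≼ setoid Carrier ↾ (_< x))

∣_∣ : Cardinal → Set
∣ κ ∣ = Cardinal.Carrier κ

⟦_⟧ : Cardinal → Setoid 0ℓ 0ℓ
⟦ κ ⟧ = setoid ∣ κ ∣

Infinite : Cardinal → Set
Infinite κ = ¬ Finite ⟦ κ ⟧

-- ν = κ⁺
_IsSuccessorOf_ : Cardinal → Cardinal → Set₁
ν IsSuccessorOf κ = ⟦ κ ⟧ ≺ ⟦ ν ⟧ × (∀ ρ → ⟦ κ ⟧ ≺ ⟦ ρ ⟧ → ⟦ ν ⟧ ≼ ⟦ ρ ⟧)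

-- Families are extensional predicates.  Taking them, like the subsets of a
-- type, at level 0ℓ is no restriction in the presence of excluded middle.
record Family (S : Setoid a ℓ) : Set (a ⊔ ℓ ⊔ lsuc 0ℓ) where
  field
    member   : Pred (Setoid.Carrier S) 0ℓ
    respects : member Respects (Setoid._≈_ S)

open Family public using (member)

module _ {S : Setoid a ℓ} where

  infix 4 _⊑_
  _⊑_ : Family S → Family S → Set a
  𝓕 ⊑ 𝓖 = member 𝓕 ⊆ member 𝓖

  Nonempty : Family S → Set a
  Nonempty 𝓕 = ∃ (member 𝓕)

  ⟪_⟫ : Family S → Setoid a ℓ
  ⟪ 𝓕 ⟫ = S ↾ member 𝓕

𝒫 : Set → Setoid (lsuc 0ℓ) 0ℓ
𝒫 X = ≐-setoid X 0ℓ

module _ {X : Set} where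

  record ChoiceFunction (𝓕 : Family (𝒫 X)) : Set₁ where
    field
      func   : Func ⟪ 𝓕 ⟫ (setoid X)
      chosen : ∀ F → Func.to func F ∈ proj₁ F

    open Func func public using (to)

  IsDiscretisation : (𝓕 : Family (𝒫 X)) → ChoiceFunction 𝓕 → Set₁
  IsDiscretisation 𝓕 f = ∀ F₀ F₁ → ¬ (F₀ ≈ F₁) → to F₀ ∉ proj₁ F₁
    where open Setoid ⟪ 𝓕 ⟫ using (_≈_)
          open ChoiceFunction f using (to)

  -- A choice function already forces every member of 𝓕 to be non-empty.
  Discrete : Family (𝒫 X) → Set₁
  Discrete 𝓕 = Nonempty 𝓕 × ∃ (IsDiscretisation 𝓕)

  HasTransversal : Family (𝒫 X) → Set₁
  HasTransversal 𝓕 =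
    Σ (ChoiceFunction 𝓕) λ f →
      Injective (Setoid._≈_ ⟪ 𝓕 ⟫) _≡_ (ChoiceFunction.to f)

record Ideal (X : Set) : Set₁ where
  field
    small    : Pred (Pred X 0ℓ) 0ℓ
    empty    : small ∅
    downward : ∀ {P Q} → P ⊆ Q → small Q → small P
    union    : ∀ {P Q} → small P → small Q → small (P ∪ Q)
    proper   : ¬ small U

open Ideal public using (small)

Regular : {X : Set} → Ideal X → Set₁
Regular {X} J =
  Σ (X → Pred X 0ℓ) λ A →
    (∀ ζ → small J (A ζ)) ×
    (∀ i → Finite (setoid X ↾ λ ζ → i ∈ ∁ (A ζ)))

module _ {X Y : Set} where

  -- ⟨ s_f : f ∈ 𝓕 ⟩ with every s_f in J
  record SequenceIn (J : Ideal X) (𝓕 : Family (X →-setoid Y)) : Set₁ where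
    field
      func : Func ⟪ 𝓕 ⟫ (𝒫 X)
      inJ  : ∀ f → small J (Func.to func f)

    open Func func public using (to)

  -- The exceptional set for f and g is s_f ∩ s_g here, and s_f ∪ s_g below.
  Separates∩ : (J : Ideal X) (𝓕 : Family (X →-setoid Y)) → SequenceIn J 𝓕 → Set
  Separates∩ J 𝓕 s = ∀ f g → ¬ (f ≈ g) →
    ∀ i → i ∈ ∁ (to f ∩ to g) → proj₁ f i ≢ proj₁ g i
    where open Setoid ⟪ 𝓕 ⟫ using (_≈_)
          open SequenceIn s using (to)

  Separates∪ : (J : Ideal X) (𝓕 : Family (X →-setoid Y)) → SequenceIn J 𝓕 → Set
  Separates∪ J 𝓕 s = ∀ f g → ¬ (f ≈ g) →
    ∀ i → i ∈ ∁ (to f ∪ to g) → proj₁ f i ≢ proj₁ g i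
    where open Setoid ⟪ 𝓕 ⟫ using (_≈_)
          open SequenceIn s using (to)

{-# OPTIONS --safe #-}

-- Both directions rest on Hessenberg's theorem: pairs, hence finite sequences,
-- of elements of an infinite cardinal are coded by its elements.
--
-- (A) ⇒ (B): let J on κ ≅ κ^{<ω} be generated by the sets {u : ζ ∉ u},
-- enumerate P = {p_ζ : ζ < κ} and let f_P(u) code the sequence of the p_ζ with
-- ζ in u.  If p_ζ is the point that a discretisation chooses in P, then s_P =
-- {u : ζ ∉ u} works, since for ζ in u the sequence f_P(u) has an entry outside
-- every other member of the subfamily.
--
-- (B) ⇒ (A): take the graphs of the functions; if i ∉ s_f, then the point
-- (i , f i) of the graph of f lies on no other graph of the subfamily.
--
-- The negative clauses are cardinal arithmetic: sets s_f as in (B), even with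
-- s_f ∪ s_g, make f ↦ (least i ∉ s_f , f i) an injection into κ × λ, and a
-- transversal is an injection into λ.
module Submission where

open import Defs
open import Level using (0ℓ; Lift; lift; lower) renaming (suc to lsuc)
open import Axiom.ExcludedMiddle using (ExcludedMiddle)
import Algebra.Construct.NaturalChoice.Max as Max
open import Data.Fin.Base using (zero; suc)
open import Data.List.Base
  using (List; []; _∷_; [_]; _++_; map; lookup; length; filter; deduplicate; cartesianProduct)
open import Data.List.Membership.Propositional using (_∈_)
open import Data.List.Membership.Propositional.Properties
  using (∈-map⁺; ∈-map⁻; ∈-++⁺ˡ; ∈-++⁺ʳ; ∈-lookup; ∈-filter⁺; ∈-filter⁻;
         ∈-deduplicate⁺; ∈-deduplicate⁻; ∈-cartesianProduct⁺)
open import Data.List.Properties using (∷-injectiveˡ)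
open import Data.List.Relation.Binary.Subset.Propositional using (_⊆_)
import Data.List.Relation.Unary.All as All
open import Data.List.Relation.Unary.AllPairs using (_∷_)
open import Data.List.Relation.Unary.Any as Any using (here; there)
open import Data.List.Relation.Unary.Any.Properties using (lookup-index)
open import Data.List.Relation.Unary.Unique.Propositional using (Unique)
open import Data.List.Relation.Unary.Unique.DecPropositional.Properties using (deduplicate-!)
open import Data.Product.Base using (Σ; ∃; _×_; _,_; proj₁; proj₂)
open import Data.Product.Function.NonDependent.Setoid using (_×-injection_)
open import Data.Product.Relation.Binary.Lex.Strict using (×-Lex; ×-wellFounded; ×-compare)
open import Data.Product.Relation.Binary.Pointwise.NonDependent using (_×ₛ_)
open import Data.Sum.Base using (_⊎_; inj₁; inj₂; [_,_]′)
open import Data.Unit.Base using (⊤; tt)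
open import Function.Base using (_∘_; id; const; case_of_)
open import Function.Bundles using (Func; Injection; Bijection; _⇔_; mk⇔)
open import Function.Construct.Composition using (injection)
open import Function.Construct.Identity using () renaming (injection to identity)
open import Function.Construct.Symmetry using (bijection-≡)
open import Induction.WellFounded using (WellFounded; Acc; acc; module All; module FixPoint)
open import Relation.Binary.Bundles using (Setoid; TotalOrder; StrictTotalOrder)
open import Relation.Binary.Core using (Rel)
open import Relation.Binary.Definitions using (tri<; tri≈; tri>)
open import Relation.Binary.Structures using (IsStrictTotalOrder)
import Relation.Binary.Construct.On as On
import Relation.Binary.Properties.StrictTotalOrder as STO
open import Relation.Binary.PropositionalEquality
  using (_≡_; _≢_; refl; sym; trans; cong; cong₂; subst; setoid; _→-setoid_)
open import Relation.Nullary.Decidable.Core using (Dec; yes; no; map′; decidable-stable)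
open import Relation.Nullary.Negation using (¬_; contradiction)
open import Relation.Unary using (Pred; _≐_; U)

private
  variable
    A B : Set

-- Injections between setoids, and finiteness by lists

infixr 9 _⨾_
_⨾_ : ∀ {a b c ℓ₁ ℓ₂ ℓ₃} {R : Setoid a ℓ₁} {S : Setoid b ℓ₂} {T : Setoid c ℓ₃} →
      R ≼ S → S ≼ T → R ≼ T
_⨾_ = injection

weaken : {D E : Pred A 0ℓ} → (∀ {x} → D x → E x) → setoid A ↾ D ≼ setoid A ↾ E
weaken D⊆E = record { to = λ (x , d) → x , D⊆E d ; cong = id ; injective = id }

forget : {D : Pred A 0ℓ} → setoid A ↾ D ≼ setoid A
forget = record { to = proj₁ ; cong = id ; injective = id }

-- The list may have repetitions and entries outside `D`; this form of finiteness passes easily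
-- along maps.
Listable : Pred A 0ℓ → Set _
Listable D = ∃ λ xs → ∀ {x} → D x → x ∈ xs

lookup-injective : ∀ {xs : List A} → Unique xs → ∀ i j → lookup xs i ≡ lookup xs j → i ≡ j
lookup-injective (_ ∷ _)   zero    zero    _  = refl
lookup-injective (x≢ ∷ _)  zero    (suc j) eq = contradiction eq (All.lookup x≢ (∈-lookup j))
lookup-injective (x≢ ∷ _)  (suc i) zero    eq = contradiction (sym eq) (All.lookup x≢ (∈-lookup i))
lookup-injective (_ ∷ xs!) (suc i) (suc j) eq = cong suc (lookup-injective xs! i j eq)

-- Hessenberg's theorem

module Classical (em : ExcludedMiddle (lsuc 0ℓ)) where

  em₀ : (A : Set) → Dec A
  em₀ A = map′ lower lift (em {Lift _ A})

  ¬∀¬⇒∃ : {P : A → Set} → ¬ (∀ x → ¬ P x) → ∃ P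
  ¬∀¬⇒∃ ¬∀¬ = decidable-stable (em₀ _) λ ¬∃ → ¬∀¬ λ x px → ¬∃ (x , px)

  -- For injective `f` this is a left inverse; `default` is the value off the range of `f`.
  preimage : A → (A → B) → B → A
  preimage {A} default f y with em₀ (∃ λ x → f x ≡ y)
  ... | yes (x , _) = x
  ... | no  _       = default

  preimage-correct : ∀ default (f : A → B) {x y} → f x ≡ y → f (preimage default f y) ≡ y
  preimage-correct default f {x} {y} fx≡y with em₀ (∃ λ x → f x ≡ y)
  ... | yes (_ , eq) = eq
  ... | no  ¬∃       = contradiction (x , fx≡y) ¬∃

  -- Keeping the entries in `D` and removing duplicates leaves a list whose `lookup` is a bijection.
  listable⇒finite : {D : Pred A 0ℓ} → Listable D → Finite (setoid A ↾ D)
  listable⇒finite {A} {D} (xs , complete) = length ys , record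
    { to        = λ i → lookup ys i , sound (∈-lookup i)
    ; cong      = cong (lookup ys)
    ; bijective = (λ {i} {j} → lookup-injective (deduplicate-! _≟_ zs) i j)
                , λ (x , d) → Any.index (listed d) , λ { refl → sym (lookup-index (listed d)) }
    }
    where
    _≟_ : (x y : A) → Dec (x ≡ y)
    x ≟ y = em₀ (x ≡ y)

    D? : ∀ x → Dec (D x)
    D? x = em₀ (D x)

    zs = filter D? xs
    ys = deduplicate _≟_ zs

    sound : ∀ {x} → x ∈ ys → D x
    sound x∈ys = proj₂ (∈-filter⁻ D? {xs = xs} (∈-deduplicate⁻ _≟_ zs x∈ys))

    listed : ∀ {x} → D x → x ∈ ys
    listed d = ∈-deduplicate⁺ _≟_ (∈-filter⁺ D? (complete d) d)

  -- Supplies distinct elements: `[]` yields a first one, and `[ u ]` one other than `u`.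
  unlisted : {D : Pred A 0ℓ} → ¬ Listable D → ∀ xs → ∃ λ x → D x × ¬ (x ∈ xs)
  unlisted ¬L xs = ¬∀¬⇒∃ λ h →
    ¬L (xs , λ {x} d → decidable-stable (em₀ _) λ x∉xs → h x (d , x∉xs))

  infinite⇒¬listable : ¬ Finite (setoid A) → ¬ Listable {A = A} U
  infinite⇒¬listable ¬F L with n , f ← listable⇒finite L = ¬F (n , record
    { to        = proj₁ ∘ Bijection.to f
    ; cong      = Bijection.cong f
    ; bijective = Bijection.injective f , λ x → Bijection.surjective f (x , tt)
    })

  -- A list for `E`, pulled back along the injection, would list `D`. The default of the inverse is
  -- an element of `D`, present because `[]` does not list `D`.
  ≼-listable : {D : Pred A 0ℓ} {E : Pred B 0ℓ} →
               setoid A ↾ D ≼ setoid B ↾ E → ¬ Listable D → ¬ Listable E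
  ≼-listable {D = D} f ¬L (ys , complete) with x , d , _ ← unlisted ¬L [] =
    ¬L (map (proj₁ ∘ g) ys , λ {x} d →
      subst (_∈ map (proj₁ ∘ g) ys)
            (to-injective (preimage-correct default (proj₁ ∘ to) {x , d} refl))
            (∈-map⁺ (proj₁ ∘ g) (complete (proj₂ (to (x , d))))))
    where
    open Injection f using (to) renaming (injective to to-injective)
    default = x , d
    g = preimage default (proj₁ ∘ to)

  -- Least elements of a well-order

  module WellOrdered (κ : Cardinal) where
    open Cardinal κ using (_<_; isStrictTotalOrder; wellFounded; initial)
    open IsStrictTotalOrder isStrictTotalOrder using (compare; irrefl) renaming (trans to <-trans)

    private
      K = ∣ κ ∣

    least : {P : Pred K 0ℓ} → ∃ P → ∃ λ x → P x × (∀ y → P y → ¬ y < x)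
    least {P} (x , px) = descend (wellFounded x) px
      where
      descend : ∀ {x} → Acc _<_ x → P x → ∃ λ x → P x × (∀ y → P y → ¬ y < x)
      descend {x} (acc rs) px with em₀ (∃ λ y → P y × y < x)
      ... | yes (_ , py , y<x) = descend (rs y<x) py
      ... | no  ¬∃             = x , px , λ y py y<x → ¬∃ (y , py , y<x)

    -- Each minimum satisfies the other predicate as well, so neither is below the other. Choices
    -- made by `least` thereby respect setoid equality.
    least-cong : {P Q : Pred K 0ℓ} → P ≐ Q → (p : ∃ P) (q : ∃ Q) →
                 proj₁ (least p) ≡ proj₁ (least q)
    least-cong (P⊆Q , Q⊆P) p q
      with x , px , x≤ ← least p | y , qy , y≤ ← least q | compare x y
    ... | tri< x<y _ _ = contradiction x<y (y≤ x (P⊆Q px))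
    ... | tri≈ _ x≡y _ = x≡y
    ... | tri> _ _ y<x = contradiction y<x (x≤ y (Q⊆P qy))

    -- The default makes the recursion in `square` total before fresh elements are known to exist.
    leastOr : K → Pred K 0ℓ → K
    leastOr default P with em₀ (∃ P)
    ... | yes p = proj₁ (least p)
    ... | no  _ = default

    leastOr-cong : ∀ default {P Q} → P ≐ Q → leastOr default P ≡ leastOr default Q
    leastOr-cong default {P} {Q} P≐Q@(P⊆Q , Q⊆P) with em₀ (∃ P) | em₀ (∃ Q)
    ... | yes p        | yes q        = least-cong P≐Q p q
    ... | yes (x , px) | no ¬q        = contradiction (x , P⊆Q px) ¬q
    ... | no ¬p        | yes (x , qx) = contradiction (x , Q⊆P qx) ¬p
    ... | no _         | no _         = refl

    leastOr-∈ : ∀ default {P} → ∃ P → P (leastOr default P)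
    leastOr-∈ default {P} p with em₀ (∃ P)
    ... | yes q = proj₁ (proj₂ (least q))
    ... | no ¬p = contradiction p ¬p

    private
      strictTotalOrder : StrictTotalOrder _ _ _
      strictTotalOrder = record { isStrictTotalOrder = isStrictTotalOrder }

    open STO strictTotalOrder using (_≤_; totalOrder)
    open Max totalOrder using (_⊔_; ⊔-sel; x≤x⊔y; x≤y⊔x)

    opaque
      -- Gödel's order of pairs: first by maximum, then lexicographically.
      _⊏_ : Rel (K × K) 0ℓ
      (a , b) ⊏ (c , d) = ×-Lex _≡_ _<_ (×-Lex _≡_ _<_ _<_) (a ⊔ b , a , b) (c ⊔ d , c , d)

      ⊏-wellFounded : WellFounded _⊏_
      ⊏-wellFounded = On.wellFounded (λ (a , b) → a ⊔ b , a , b)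
        (×-wellFounded wellFounded (×-wellFounded wellFounded wellFounded))

      ⊏-connex : ∀ p q → p ≢ q → p ⊏ q ⊎ q ⊏ p
      ⊏-connex (a , b) (c , d) p≢q
        with ×-compare sym compare (×-compare sym compare compare) (a ⊔ b , a , b) (c ⊔ d , c , d)
      ... | tri< p⊏q _ _              = inj₁ p⊏q
      ... | tri≈ _ (_ , refl , refl) _ = contradiction refl p≢q
      ... | tri> _ _ q⊏p              = inj₂ q⊏p

      -- The reason for comparing maxima first: all predecessors of a pair lie in the square of a
      -- segment.
      ⊏⇒≤⊔ : ∀ {a b c d} → (a , b) ⊏ (c , d) → a ≤ c ⊔ d × b ≤ c ⊔ d
      ⊏⇒≤⊔ {a} {b} {c} {d} p⊏q = ≤-trans (x≤x⊔y a b) m≤ , ≤-trans (x≤y⊔x a b) m≤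
        where
        open TotalOrder totalOrder using () renaming (trans to ≤-trans)
        m≤ : a ⊔ b ≤ c ⊔ d
        m≤ = [ inj₁ , inj₂ ∘ proj₁ ]′ p⊏q

    ⊔-closed : ∀ (D : Pred K 0ℓ) {a b} → D a → D b → D (a ⊔ b)
    ⊔-closed D {a} {b} da db =
      [ (λ eq → subst D (sym eq) da) , (λ eq → subst D (sym eq) db) ]′ (⊔-sel a b)

    Square : Pred K 0ℓ → Set _
    Square D = (⟦ κ ⟧ ↾ D ×ₛ ⟦ κ ⟧ ↾ D) ≼ ⟦ κ ⟧ ↾ D

    -- Pairing with u or with v ≢ u tells the end point m from the rest.
    ≤-segment : ∀ m → ¬ Listable (_< m) → Square (_< m) → ⟦ κ ⟧ ↾ (_≤ m) ≼ ⟦ κ ⟧ ↾ (_< m)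
    ≤-segment m ¬L sq
      with u , u<m , _ ← unlisted ¬L []
      with v , v<m , v∉ ← unlisted ¬L [ u ] = record
      { to        = to′
      ; cong      = λ { {_ , x≤} {_ , y≤} refl → to′-cong x≤ y≤ }
      ; injective = λ {x} {y} → to′-injective x y
      }
      where
      open Injection sq using (to; injective) renaming (cong to to-cong)
      v≢u : v ≢ u
      v≢u = v∉ ∘ here

      to′ : ∃ (_≤ m) → ∃ (_< m)
      to′ (x , inj₁ x<m) = to ((v , v<m) , (x , x<m))
      to′ (x , inj₂ _)   = to ((u , u<m) , (u , u<m))

      to′-cong : ∀ {x} (p q : x ≤ m) → proj₁ (to′ (x , p)) ≡ proj₁ (to′ (x , q))
      to′-cong (inj₁ _)   (inj₁ _)   = to-cong (refl , refl)
      to′-cong (inj₁ x<m) (inj₂ x≡m) = contradiction x<m (irrefl x≡m)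
      to′-cong (inj₂ x≡m) (inj₁ x<m) = contradiction x<m (irrefl x≡m)
      to′-cong (inj₂ _)   (inj₂ _)   = refl

      to′-injective : ∀ x y → proj₁ (to′ x) ≡ proj₁ (to′ y) → proj₁ x ≡ proj₁ y
      to′-injective (_ , inj₁ _)   (_ , inj₁ _)   eq = proj₂ (injective eq)
      to′-injective (_ , inj₁ _)   (_ , inj₂ _)   eq = contradiction (proj₁ (injective eq)) v≢u
      to′-injective (_ , inj₂ _)   (_ , inj₁ _)   eq = contradiction (sym (proj₁ (injective eq))) v≢u
      to′-injective (_ , inj₂ x≡m) (_ , inj₂ y≡m) eq = trans x≡m (sym y≡m)

    -- Along ⊏, send each pair to the least unused element of D.  If none were
    -- left at a pair with maximum m, then D would be covered by the square of
    -- {x : x ≤ m}, contradicting one of the hypotheses.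
    square : (D : Pred K 0ℓ) → ¬ Listable D →
             (∀ m → D m → ¬ (⟦ κ ⟧ ↾ D ≼ ⟦ κ ⟧ ↾ (_< m))) →
             (∀ m → D m → Listable (_< m) ⊎ Square (_< m)) →
             Square D
    square D ¬L D⋠ below = record
      { to        = λ ((a , da) , (b , db)) → e (a , b) , e-∈ (da , db)
      ; cong      = λ { (refl , refl) → refl }
      ; injective = λ { {(a , da) , (b , db)} {(c , dc) , (d , dd)} eq →
                        e-injective (da , db) (dc , dd) eq }
      }
      where
      default = proj₁ (unlisted ¬L [])

      Fresh : (p : K × K) → (∀ {q} → q ⊏ p → K) → Pred K 0ℓ
      Fresh p IH x = D x × (∀ {q} (q⊏p : q ⊏ p) → IH q⊏p ≢ x)

      step : ∀ p → (∀ {q} → q ⊏ p → K) → K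
      step p IH = leastOr default (Fresh p IH)

      -- Unfolding the recursion needs this, since functions that agree pointwise need not be equal.
      step-ext : ∀ p {IH IH′ : ∀ {q} → q ⊏ p → K} →
                 (∀ {q} (q⊏p : q ⊏ p) → IH q⊏p ≡ IH′ q⊏p) → step p IH ≡ step p IH′
      step-ext p eq = leastOr-cong default
        ( (λ (d , ≢) → d , λ q⊏p → ≢ q⊏p ∘ trans (eq q⊏p))
        , (λ (d , ≢) → d , λ q⊏p → ≢ q⊏p ∘ trans (sym (eq q⊏p))))

      e : K × K → K
      e = All.wfRec ⊏-wellFounded 0ℓ (const K) step

      module _ {a b} (da : D a) (db : D b) where
        private
          m = a ⊔ b
          dm : D m
          dm = ⊔-closed D da db

          Covered : Set
          Covered = ∀ x → D x → ∃ λ q → q ⊏ (a , b) × e q ≡ x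

          -- `m ∷ xs` lists {x : x ≤ m}, so the values of `e` on its square would list `D`.
          listable-case : Listable (_< m) → ¬ Covered
          listable-case (xs , complete) cov =
            ¬L (map e (cartesianProduct (m ∷ xs) (m ∷ xs)) , λ {x} d → listed (cov x d))
            where
            complete′ : ∀ {x} → x ≤ m → x ∈ m ∷ xs
            complete′ (inj₁ x<m) = there (complete x<m)
            complete′ (inj₂ x≡m) = here x≡m

            listed : ∀ {x} → (∃ λ q → q ⊏ (a , b) × e q ≡ x) →
                     x ∈ map e (cartesianProduct (m ∷ xs) (m ∷ xs))
            listed ((c , d) , q⊏ , refl) with c≤ , d≤ ← ⊏⇒≤⊔ q⊏ =
              ∈-map⁺ e (∈-cartesianProduct⁺ (complete′ c≤) (complete′ d≤))

          square-case : ¬ Listable (_< m) → Square (_< m) → ¬ Covered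
          -- `D` would inject into the square of {x : x ≤ m}, then into that of {x : x < m}, and
          -- finally into {x : x < m}.
          square-case ¬Lm sq cov = D⋠ m dm (g ⨾ (h ×-injection h) ⨾ sq)
            where
            h = ≤-segment m ¬Lm sq

            Pre : Set
            Pre = ∃ (_⊏ (a , b))

            default′ : Pre
            default′ with q , q⊏ , _ ← cov a da = q , q⊏

            k : K → Pre
            k = preimage default′ (e ∘ proj₁)

            e-k : ∀ {x} → D x → e (proj₁ (k x)) ≡ x
            e-k {x} d = let (q , q⊏ , eq) = cov x d in preimage-correct default′ (e ∘ proj₁) {q , q⊏} eq

            g : ⟦ κ ⟧ ↾ D ≼ (⟦ κ ⟧ ↾ (_≤ m) ×ₛ ⟦ κ ⟧ ↾ (_≤ m))
            g = record
              { to        = λ (x , _) → let ((c , d) , q⊏) = k x in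
                                         (c , proj₁ (⊏⇒≤⊔ q⊏)) , (d , proj₂ (⊏⇒≤⊔ q⊏))
              ; cong      = λ { refl → refl , refl }
              ; injective = λ { {x , dx} {y , dy} (eq₁ , eq₂) →
                  trans (sym (e-k dx)) (trans (cong e (cong₂ _,_ eq₁ eq₂)) (e-k dy)) }
              }

        fresh : ∃ (Fresh (a , b) λ {q} _ → e q)
        fresh = ¬∀¬⇒∃ λ h → ¬covered λ x d → decidable-stable (em₀ _) λ ¬∃ →
          h x (d , λ {q} q⊏ eq → ¬∃ (q , q⊏ , eq))
          where
          ¬covered : ¬ Covered
          ¬covered with em₀ (Listable (_< m)) | below m dm
          ... | yes L  | _       = listable-case L
          ... | no  _  | inj₁ L  = listable-case L
          ... | no  ¬L | inj₂ sq = square-case ¬L sq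

        e-fresh : Fresh (a , b) (λ {q} _ → e q) (e (a , b))
        e-fresh = subst (Fresh (a , b) λ {q} _ → e q)
          (sym (FixPoint.unfold-wfRec ⊏-wellFounded (const K) step step-ext))
          (leastOr-∈ default fresh)

      e-∈ : ∀ {a b} → D a × D b → D (e (a , b))
      e-∈ (da , db) = proj₁ (e-fresh da db)

      e-injective : ∀ {a b c d} → D a × D b → D c × D d → e (a , b) ≡ e (c , d) → a ≡ c × b ≡ d
      e-injective {a} {b} {c} {d} (da , db) (dc , dd) eq with em₀ ((a , b) ≡ (c , d))
      ... | yes refl = refl , refl
      ... | no  p≢q with ⊏-connex _ _ p≢q
      ...   | inj₁ p⊏q = contradiction eq (proj₂ (e-fresh dc dd) p⊏q)
      ...   | inj₂ q⊏p = contradiction (sym eq) (proj₂ (e-fresh da db) q⊏p)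

    -- Well-founded induction. An infinite segment that injects into no shorter one is handled by
    -- `square`; any other infinite segment borrows the pairing of a shorter one into which it
    -- injects.
    segment-square : ∀ x → Listable (_< x) ⊎ Square (_< x)
    segment-square = All.wfRec wellFounded 0ℓ _ λ x IH → go x IH
      where
      go : ∀ x → (∀ {y} → y < x → Listable (_< y) ⊎ Square (_< y)) → Listable (_< x) ⊎ Square (_< x)
      go x IH with em₀ (Listable (_< x))
      ... | yes L = inj₁ L
      ... | no ¬L with em₀ (∃ λ y → y < x × ⟦ κ ⟧ ↾ (_< x) ≼ ⟦ κ ⟧ ↾ (_< y))
      ...   | no ¬∃ = inj₂ (square (_< x) ¬L (λ m m<x f → ¬∃ (m , m<x , f)) λ m → IH)
      ...   | yes (y , y<x , f) with IH y<x
      ...     | inj₁ L  = contradiction L (≼-listable f ¬L)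
      ...     | inj₂ sq = inj₂ ((f ×-injection f) ⨾ sq ⨾ weaken (λ z<y → <-trans z<y y<x))

    -- Pairs and finite lists of elements of a cardinal

    opaque
      -- `square` applies to all of `κ`, because an initial ordinal injects into none of its proper
      -- segments.
      pairing-≼ : Infinite κ → (⟦ κ ⟧ ×ₛ ⟦ κ ⟧) ≼ ⟦ κ ⟧
      pairing-≼ inf = (all ×-injection all) ⨾
        square U (infinite⇒¬listable inf) (λ m _ f → initial m (all ⨾ f)) (λ m _ → segment-square m) ⨾
        forget
        where
        all : ⟦ κ ⟧ ≼ ⟦ κ ⟧ ↾ U
        all = record { to = _, tt ; cong = id ; injective = id }

    opaque
      -- Nested pairing, with the distinct tags `u` for the empty list and `v` for a cons.
      List-≼ : Infinite κ → setoid (List K) ≼ ⟦ κ ⟧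
      List-≼ inf
        with u , _ , _ ← unlisted (infinite⇒¬listable inf) []
        with v , _ , v∉ ← unlisted (infinite⇒¬listable inf) [ u ] = record
        { to = encode ; cong = cong encode ; injective = λ {xs} {ys} → encode-injective xs ys }
        where
        open Injection (pairing-≼ inf) using (to; injective)
        v≢u : v ≢ u
        v≢u = v∉ ∘ here

        encode : List K → K
        encode []       = to (u , u)
        encode (x ∷ xs) = to (v , to (x , encode xs))

        encode-injective : ∀ xs ys → encode xs ≡ encode ys → xs ≡ ys
        encode-injective []       []       _  = refl
        encode-injective []       (_ ∷ _)  eq = contradiction (sym (proj₁ (injective eq))) v≢u
        encode-injective (_ ∷ _)  []       eq = contradiction (proj₁ (injective eq)) v≢u
        encode-injective (x ∷ xs) (y ∷ ys) eq =
          let (x≡y , xs≡ys) = injective (proj₂ (injective eq)) in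
          cong₂ _∷_ x≡y (encode-injective xs ys xs≡ys)

-- Families enumerated by an index type

record Enumeration {a} {S : Setoid a 0ℓ} (I : Set) (𝓕 : Family S) : Set a where
  open Setoid S using (_≈_)
  field
    at        : I → Setoid.Carrier S
    injective : ∀ {i j} → at i ≈ at j → i ≡ j
    listed    : ∀ i → member 𝓕 (at i)
    index     : ∀ {x} → member 𝓕 x → I
    at-index  : ∀ {x} (p : member 𝓕 x) → x ≈ at (index p)

  index-cong : ∀ {x y} (p : member 𝓕 x) (q : member 𝓕 y) → x ≈ y → index p ≡ index q
  index-cong p q x≈y = injective (S.trans (S.sym (at-index p)) (S.trans x≈y (at-index q)))
    where module S = Setoid S

  index-injective : ∀ {x y} (p : member 𝓕 x) (q : member 𝓕 y) → index p ≡ index q → x ≈ y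
  index-injective p q eq = S.trans (at-index p) (S.trans (S.reflexive (cong at eq)) (S.sym (at-index q)))
    where module S = Setoid S

  bijection : ⟪ 𝓕 ⟫ ≋ setoid I
  bijection = record
    { to        = λ (_ , p) → index p
    ; cong      = λ { {_ , p} {_ , q} → index-cong p q }
    ; bijective = (λ { {_ , p} {_ , q} → index-injective p q })
                , λ i → (at i , listed i) , λ { {x , p} x≈ →
                    injective (Setoid.trans S (Setoid.sym S (at-index p)) x≈) }
    }

≋⇒enumeration : ∀ {a} {S : Setoid a 0ℓ} {I : Set} {𝓕 : Family S} → ⟪ 𝓕 ⟫ ≋ setoid I → Enumeration I 𝓕
≋⇒enumeration {S = S} f = record
  { at        = λ i → proj₁ (from i)
  ; injective = λ {i} {j} eq → trans (sym (to-from i)) (trans (cong-to eq) (to-from j))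
  ; listed    = λ i → proj₂ (from i)
  ; index     = λ {x} p → to (x , p)
  ; at-index  = λ {x} p → to-injective (sym (to-from (to (x , p))))
  }
  where
  open Bijection f using (to; strictlySurjective) renaming (cong to cong-to; injective to to-injective)
  from = λ i → proj₁ (strictlySurjective i)
  to-from = λ i → proj₂ (strictlySurjective i)

module _ {a} {S : Setoid a 0ℓ} {I : Set} where
  open Setoid S using (_≈_) renaming (Carrier to C; trans to ≈-trans; sym to ≈-sym; refl to ≈-refl)

  image : (I → C) → Family S
  image at = record
    { member   = λ x → ∃ λ i → x ≈ at i
    ; respects = λ x≈y (i , x≈) → i , ≈-trans (≈-sym x≈y) x≈
    }

  image-enumeration : (at : I → C) → (∀ {i j} → at i ≈ at j → i ≡ j) → Enumeration I (image at)
  image-enumeration at injective = record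
    { at        = at
    ; injective = injective
    ; listed    = λ i → i , ≈-refl
    ; index     = proj₁
    ; at-index  = proj₂
    }

-- Subfamilies carried along a common index set

module Transfer {a b} {S : Setoid a 0ℓ} {T : Setoid b 0ℓ} {I : Set}
                {𝓢 : Family S} {𝓣 : Family T} (E : Enumeration I 𝓢) (F : Enumeration I 𝓣) where
  private
    module S = Setoid S
    module T = Setoid T
    module E = Enumeration E
    module F = Enumeration F

  transfer : Family S → Family T
  transfer 𝓧 = record
    { member   = λ y → ∃ λ i → y T.≈ F.at i × member 𝓧 (E.at i)
    ; respects = λ y≈z (i , y≈ , p) → i , T.trans (T.sym y≈z) y≈ , p
    }

  transfer-⊑ : ∀ 𝓧 → transfer 𝓧 ⊑ 𝓣
  transfer-⊑ 𝓧 (i , y≈ , _) = Family.respects 𝓣 (T.sym y≈) (F.listed i)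

  transfer-∋ : ∀ 𝓧 {i} → member 𝓧 (E.at i) → member (transfer 𝓧) (F.at i)
  transfer-∋ 𝓧 p = _ , T.refl , p

  transfer-≼ : ∀ 𝓧 → ⟪ transfer 𝓧 ⟫ ≼ ⟪ 𝓧 ⟫
  transfer-≼ 𝓧 = record
    { to        = λ (_ , i , _ , p) → E.at i , p
    ; cong      = λ { {_ , _ , y≈ , _} {_ , _ , z≈ , _} y≈z →
        S.reflexive (cong E.at (F.injective (T.trans (T.sym y≈) (T.trans y≈z z≈)))) }
    ; injective = λ { {_ , _ , y≈ , _} {_ , _ , z≈ , _} eq →
        T.trans y≈ (T.trans (T.reflexive (cong F.at (E.injective eq))) (T.sym z≈)) }
    }

  -- The injection of the transferred family into the original settles both halves of `≺`.
  transfer-≺ : ∀ 𝓧 {c ℓ} {V : Setoid c ℓ} → ⟪ 𝓧 ⟫ ≺ V → ⟪ transfer 𝓧 ⟫ ≺ V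
  transfer-≺ 𝓧 (𝓧≼V , V⋠𝓧) = transfer-≼ 𝓧 ⨾ 𝓧≼V , λ V≼ → V⋠𝓧 (V≼ ⨾ transfer-≼ 𝓧)

-- The two implications

module Equivalence-of-A-and-B
  (em : ExcludedMiddle (lsuc 0ℓ)) (μ Λ θ κ : Cardinal)
  (Λ-infinite : Infinite Λ) (θ-infinite : Infinite θ) (κ-infinite : Infinite κ)
  (Λ≺μ : ⟦ Λ ⟧ ≺ ⟦ μ ⟧) (κ≼Λ : ⟦ κ ⟧ ≼ ⟦ Λ ⟧) where

  open Classical em
  private
    module κ = WellOrdered κ
    module Λ = WellOrdered Λ
    K = ∣ κ ∣
    L = ∣ Λ ∣

  κ×Λ≼Λ : (⟦ κ ⟧ ×ₛ ⟦ Λ ⟧) ≼ ⟦ Λ ⟧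
  κ×Λ≼Λ = (κ≼Λ ×-injection identity ⟦ Λ ⟧) ⨾ Λ.pairing-≼ Λ-infinite

  open Injection κ×Λ≼Λ using () renaming (to to pair; injective to pair-injective)

  μ⋠Λ : ∀ {a ℓ} {S : Setoid a ℓ} → S ≋ ⟦ μ ⟧ → ¬ (S ≼ ⟦ Λ ⟧)
  μ⋠Λ f g = proj₂ Λ≺μ (Bijection.injection (bijection-≡ f) ⨾ g)

  -- Points outside the sets s_f, and the bound by `Λ`

  module Point {J : Ideal K} {𝓕 : Family (K →-setoid L)} (s : SequenceIn J 𝓕) where
    open SequenceIn s using (func; inJ) renaming (to to s-to)

    -- A set in `J` containing every `i` would make `U` small, contrary to properness.
    outside : ∀ f → ∃ λ i → ¬ s-to f i
    outside f = ¬∀¬⇒∃ λ h → Ideal.proper J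
      (Ideal.downward J (λ {i} _ → decidable-stable (em₀ _) (h i)) (inJ f))

    -- The least such index, not an arbitrary one, so that pointwise equal functions get the same
    -- point.
    point : ∃ (member 𝓕) → K
    point f = proj₁ (κ.least (outside f))

    point-∉ : ∀ f → ¬ s-to f (point f)
    point-∉ f = proj₁ (proj₂ (κ.least (outside f)))

    point-cong : ∀ {f g} → Setoid._≈_ ⟪ 𝓕 ⟫ f g → point f ≡ point g
    point-cong {f} {g} f≈g = κ.least-cong
      (let (s⊆t , t⊆s) = Func.cong func {f} {g} f≈g in (λ ∉s → ∉s ∘ t⊆s) , (λ ∉t → ∉t ∘ s⊆t))
      (outside f) (outside g)

    -- If `f` and `g` had the same image, their common point would lie outside both sets while `f`
    -- and `g` agree there.
    separates∪⇒≼Λ : Separates∪ J 𝓕 s → ⟪ 𝓕 ⟫ ≼ ⟦ Λ ⟧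
    separates∪⇒≼Λ sep = record
      { to        = λ f → pair (point f , proj₁ f (point f))
      ; cong      = λ {f} {g} f≈g → cong pair (cong₂ _,_ (point-cong {f} {g} f≈g)
                      (trans (cong (proj₁ f) (point-cong {f} {g} f≈g)) (f≈g (point g))))
      ; injective = λ {f} {g} eq → decidable-stable (em₀ _) λ f≉g →
          let (i≡j , fi≡gj) = pair-injective eq in
          sep f g f≉g (point f)
            [ point-∉ f , subst (λ i → ¬ s-to g i) (sym i≡j) (point-∉ g) ]′
            (trans fi≡gj (cong (proj₁ g) (sym i≡j)))
      }

  -- A point outside the union is outside the intersection, so the bound by `Λ` serves both kinds of
  -- separation.
  ∩⇒∪ : (J : Ideal K) (𝓕 : Family (K →-setoid L)) (s : SequenceIn J 𝓕) → Separates∩ J 𝓕 s → Separates∪ J 𝓕 s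
  ∩⇒∪ _ _ _ sep f g f≉g i i∉ = sep f g f≉g i (i∉ ∘ inj₁ ∘ proj₁)

  StatementA StatementB : Set₁
  StatementA =
    Σ (Family (𝒫 L)) λ 𝓟* →
        ⟪ 𝓟* ⟫ ≋ ⟦ μ ⟧
      × (∀ P → member 𝓟* P → ⟦ Λ ⟧ ↾ P ≼ ⟦ κ ⟧)
      × (∀ 𝓟 → 𝓟 ⊑ 𝓟* → ⟪ 𝓟 ⟫ ≋ ⟦ μ ⟧ → ¬ HasTransversal 𝓟)
      × (∀ 𝓟 → 𝓟 ⊑ 𝓟* → Nonempty 𝓟 → ⟪ 𝓟 ⟫ ≺ ⟦ θ ⟧ → Discrete 𝓟)
  StatementB =
    Σ (Ideal K) λ J → Regular J ×
      (Σ (Family (K →-setoid L)) λ 𝓕* →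
          ⟪ 𝓕* ⟫ ≋ ⟦ μ ⟧
        × (∀ 𝓕 → 𝓕 ⊑ 𝓕* → ⟪ 𝓕 ⟫ ≺ ⟦ θ ⟧ → ∃ (Separates∩ J 𝓕))
        × (∀ 𝓕 → 𝓕 ⊑ 𝓕* → ⟪ 𝓕 ⟫ ≋ ⟦ μ ⟧ → ¬ ∃ (Separates∩ J 𝓕))
        × (∀ Λ⁺ → Λ⁺ IsSuccessorOf Λ →
             ∀ 𝓕 → 𝓕 ⊑ 𝓕* → ⟦ Λ⁺ ⟧ ≼ ⟪ 𝓕 ⟫ → ¬ ∃ (Separates∪ J 𝓕)))

  -- (A) implies (B)

  module A⇒B (𝓟* : Family (𝒫 L)) (𝓟*≋μ : ⟪ 𝓟* ⟫ ≋ ⟦ μ ⟧)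
             (κ-small : ∀ P → member 𝓟* P → ⟦ Λ ⟧ ↾ P ≼ ⟦ κ ⟧)
             (discrete : ∀ 𝓟 → 𝓟 ⊑ 𝓟* → Nonempty 𝓟 → ⟪ 𝓟 ⟫ ≺ ⟦ θ ⟧ → Discrete 𝓟) where

    private
      E : Enumeration ∣ μ ∣ 𝓟*
      E = ≋⇒enumeration 𝓟*≋μ
      module E = Enumeration E
      module 𝒫L = Setoid (𝒫 L)

    -- A discretisation of the one-member subfamily chooses an element. The distinct elements `t`
    -- and `u` of `θ` show that one member is fewer than `θ`.
    inhabited : ∀ m → ∃ (E.at m)
    inhabited m
      with t , _ , _ ← unlisted (infinite⇒¬listable θ-infinite) []
      with u , _ , u∉ ← unlisted (infinite⇒¬listable θ-infinite) [ t ]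
      with _ , c , _ ← discrete
             (image {I = ⊤} (const (E.at m)))
             (λ (_ , P≐) → Family.respects 𝓟* (𝒫L.sym P≐) (E.listed m))
             (E.at m , tt , 𝒫L.refl)
             ( record { to = const t ; cong = const refl
                      ; injective = λ { {_ , _ , P≐} {_ , _ , Q≐} _ → 𝒫L.trans P≐ (𝒫L.sym Q≐) } }
             , λ f → let open Injection f in u∉ (here (injective {u} {t}
                 (𝒫L.trans (proj₂ (proj₂ (to u))) (𝒫L.sym (proj₂ (proj₂ (to t))))))) )
      = _ , ChoiceFunction.chosen c (E.at m , tt , 𝒫L.refl)

    private
      module h m = Injection (κ-small (E.at m) (E.listed m))

    -- The enumeration p_ζ of the `m`-th set, possibly with repetitions, as an inverse of its
    -- injection into `κ`.
    elem : ∀ m → K → ∃ (E.at m)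
    elem m = preimage (inhabited m) (h.to m)

    elem-h : ∀ m x → proj₁ (elem m (h.to m x)) ≡ proj₁ x
    elem-h m x = h.injective m (preimage-correct (inhabited m) (h.to m) {x} refl)

    open Injection (κ.List-≼ κ-infinite) using () renaming (to to encode; injective to encode-injective)
    open Injection (Λ.List-≼ Λ-infinite) using () renaming (to to code; injective to code-injective)

    -- Every element of `κ` is read as a finite sequence; those that code none are read as the empty
    -- one.
    decode : K → List K
    decode = preimage [] encode

    decode-encode : ∀ ζs → decode (encode ζs) ≡ ζs
    decode-encode ζs = encode-injective (preimage-correct [] encode {ζs} refl)

    func : ∣ μ ∣ → K → L
    func m i = code (map (proj₁ ∘ elem m) (decode i))

    -- With `ζ` the position of `x`, evaluation at the code of `[ ζ ]` reveals the ζ-th point, so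
    -- `x` is also the ζ-th point of the `n`-th set.
    func-⊆ : ∀ {m n} → (∀ i → func m i ≡ func n i) → ∀ {x} → E.at m x → E.at n x
    func-⊆ {m} {n} eq {x} px = subst (E.at n) (trans (sym ζ-eq) (elem-h m (x , px))) (proj₂ (elem n ζ))
      where
      ζ = h.to m (x , px)
      ζ-eq : proj₁ (elem m ζ) ≡ proj₁ (elem n ζ)
      ζ-eq = ∷-injectiveˡ (subst (λ ζs → map (proj₁ ∘ elem m) ζs ≡ map (proj₁ ∘ elem n) ζs)
                                 (decode-encode [ ζ ]) (code-injective (eq (encode [ ζ ]))))

    func-injective : ∀ {m n} → (∀ i → func m i ≡ func n i) → m ≡ n
    func-injective eq = E.injective (func-⊆ eq , func-⊆ (sym ∘ eq))

    -- P is in the ideal generated by the sets {i : ζ ∉ decode i} iff P is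
    -- disjoint from {i : ζs ⊆ decode i} for some finite list ζs.
    J : Ideal K
    J = record
      { small    = λ P → ∃ λ ζs → ∀ {i} → P i → ¬ (ζs ⊆ decode i)
      ; empty    = [] , λ ()
      ; downward = λ P⊆Q (ζs , avoid) → ζs , avoid ∘ P⊆Q
      ; union    = λ (ζs , avoid) (ζs′ , avoid′) → ζs ++ ζs′ , λ
          { (inj₁ p) ⊆i → avoid p (⊆i ∘ ∈-++⁺ˡ)
          ; (inj₂ q) ⊆i → avoid′ q (⊆i ∘ ∈-++⁺ʳ ζs) }
      ; proper   = λ (ζs , avoid) → avoid {encode ζs} tt
          λ {ζ} → subst (ζ ∈_) (sym (decode-encode ζs))
      }

    generator : K → Pred K 0ℓ
    generator ζ i = ¬ (ζ ∈ decode i)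

    generator-small : ∀ ζ → small J (generator ζ)
    generator-small ζ = [ ζ ] , λ ζ∉ ⊆i → ζ∉ (⊆i (here refl))

    -- `i` lies outside `generator ζ` only for the entries `ζ` of the finite list `decode i`.
    regular : Regular J
    regular = generator , generator-small , λ i →
      listable⇒finite (decode i , λ ¬∉ → decidable-stable (em₀ _) ¬∉)

    private
      F = image-enumeration {S = K →-setoid L} func func-injective
      module F = Enumeration F
      open Transfer F E

    module _ (𝓕 : Family (K →-setoid L)) (𝓕⊑ : 𝓕 ⊑ image func) where

      module _ (disc : Discrete (transfer 𝓕)) where
        private
          module c = ChoiceFunction (proj₁ (proj₂ disc))

          set : ∀ {m} → member 𝓕 (func m) → ∃ (member (transfer 𝓕))
          set {m} p = E.at m , transfer-∋ 𝓕 p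

          -- The position of the point that the discretisation chooses in the `m`-th set.
          ζ : ∀ {m} → member 𝓕 (func m) → K
          ζ {m} p = h.to m (c.to (set p) , c.chosen (set p))

          ζ-cong : ∀ {m n} (p : member 𝓕 (func m)) (q : member 𝓕 (func n)) → m ≡ n → ζ p ≡ ζ q
          ζ-cong {m} p q refl = h.cong m (Func.cong c.func {set p} {set q} 𝒫L.refl)

          at-index : ((f , p) : ∃ (member 𝓕)) → member 𝓕 (func (F.index (𝓕⊑ p)))
          at-index (f , p) = Family.respects 𝓕 (F.at-index (𝓕⊑ p)) p

        sequence : SequenceIn J 𝓕
        sequence = record
          { func = record
            { to   = λ f → generator (ζ (at-index f))
            ; cong = λ { {f , p} {g , q} f≈g →
                𝒫K.reflexive (cong generator (ζ-cong (at-index (f , p)) (at-index (g , q))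
                  (F.index-cong (𝓕⊑ p) (𝓕⊑ q) f≈g))) }
            }
          ; inJ  = λ f → generator-small (ζ (at-index f))
          }
          where module 𝒫K = Setoid (𝒫 K)

        -- The chosen point is an entry of the list coded by `func m i`. Were the codes equal, it
        -- would be an entry for `n` too, hence a point of the `n`-th set, against the
        -- discretisation.
        separate : ∀ {m n} (p : member 𝓕 (func m)) (q : member 𝓕 (func n)) → ¬ (m ≡ n) →
                   ∀ {i} → ζ p ∈ decode i → func m i ≢ func n i
        separate {m} {n} p q m≢n {i} ζ∈ eq =
          proj₂ (proj₂ disc) (set p) (set q) (m≢n ∘ E.injective) (subst (E.at n) y≡ (proj₂ (elem n η)))
          where
          x∈ : proj₁ (elem m (ζ p)) ∈ map (proj₁ ∘ elem n) (decode i)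
          x∈ = subst (_ ∈_) (code-injective eq) (∈-map⁺ (proj₁ ∘ elem m) ζ∈)
          η = proj₁ (∈-map⁻ (proj₁ ∘ elem n) x∈)
          y≡ : proj₁ (elem n η) ≡ c.to (set p)
          y≡ = trans (sym (proj₂ (proj₂ (∈-map⁻ (proj₁ ∘ elem n) x∈)))) (elem-h m _)

        -- Outside the intersection of the two generators, one of the chosen positions occurs in
        -- `decode i`; `separate` is applied from that side.
        separates∩ : Separates∩ J 𝓕 sequence
        separates∩ (f , p) (g , q) f≉g i i∉ fi≡gi = case em₀ (ζ (at-index (f , p)) ∈ decode i) of λ where
          (yes ζ∈) → separate (at-index (f , p)) (at-index (g , q))
                (f≉g ∘ F.index-injective (𝓕⊑ p) (𝓕⊑ q)) ζ∈
                (trans (sym (F.at-index (𝓕⊑ p) i)) (trans fi≡gi (F.at-index (𝓕⊑ q) i)))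
          (no ζ∉)  → separate (at-index (g , q)) (at-index (f , p))
                (f≉g ∘ F.index-injective (𝓕⊑ p) (𝓕⊑ q) ∘ sym)
                (decidable-stable (em₀ _) λ η∉ → i∉ (ζ∉ , η∉))
                (trans (sym (F.at-index (𝓕⊑ q) i)) (trans (sym fi≡gi) (F.at-index (𝓕⊑ p) i)))

      separated : ⟪ 𝓕 ⟫ ≺ ⟦ θ ⟧ → ∃ (Separates∩ J 𝓕)
      separated 𝓕≺θ with em₀ (Nonempty 𝓕)
      ... | yes (f , p) = sequence disc , separates∩ disc
        where
        disc : Discrete (transfer 𝓕)
        disc = discrete (transfer 𝓕) (transfer-⊑ 𝓕)
          (_ , transfer-∋ 𝓕 (Family.respects 𝓕 (F.at-index (𝓕⊑ p)) p)) (transfer-≺ 𝓕 𝓕≺θ)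
      -- The empty subfamily, to which discreteness does not apply, has the empty sequence.
      ... | no ¬∃ = record
        { func = record { to = λ f → contradiction f ¬∃
                        ; cong = λ {f} _ → contradiction f ¬∃ }
        ; inJ  = λ f → contradiction f ¬∃
        } , λ f → contradiction f ¬∃

    statementB : StatementB
    statementB = J , regular , image func , F.bijection , separated
      -- For both negative clauses: a separated family injects into `Λ`, whereas neither `μ` nor
      -- `Λ⁺` does.
      , (λ 𝓕 _ 𝓕≋μ (s , sep) →
           μ⋠Λ 𝓕≋μ (Point.separates∪⇒≼Λ s (∩⇒∪ J 𝓕 s sep)))
      , (λ Λ⁺ (Λ≺Λ⁺ , _) 𝓕 _ Λ⁺≼𝓕 (s , sep) →
           proj₂ Λ≺Λ⁺ (Λ⁺≼𝓕 ⨾ Point.separates∪⇒≼Λ s sep))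

  -- (B) implies (A)

  module B⇒A (J : Ideal K) (𝓕* : Family (K →-setoid L)) (𝓕*≋μ : ⟪ 𝓕* ⟫ ≋ ⟦ μ ⟧)
             (separated : ∀ 𝓕 → 𝓕 ⊑ 𝓕* → ⟪ 𝓕 ⟫ ≺ ⟦ θ ⟧ → ∃ (Separates∩ J 𝓕)) where

    private
      F : Enumeration ∣ μ ∣ 𝓕*
      F = ≋⇒enumeration 𝓕*≋μ
      module F = Enumeration F

    graph : ∣ μ ∣ → Pred L 0ℓ
    graph m x = ∃ λ i → x ≡ pair (i , F.at m i)

    -- A graph has just one value over each `i`, so inclusion already forces equality.
    graph-⊆ : ∀ {m n} → (∀ {x} → graph m x → graph n x) → ∀ i → F.at m i ≡ F.at n i
    graph-⊆ {m} {n} ⊆ i with j , eq ← ⊆ (i , refl) with i≡j , fi≡gj ← pair-injective eq =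
      trans fi≡gj (cong (F.at n) (sym i≡j))

    private
      E = image-enumeration {S = 𝒫 L} graph (λ (⊆ , _) → F.injective (graph-⊆ ⊆))
      module E = Enumeration E
      open Transfer E F

    -- A point of a graph is determined by its first coordinate, which ranges over `κ`.
    κ-small : ∀ P → member (image {S = 𝒫 L} graph) P → ⟦ Λ ⟧ ↾ P ≼ ⟦ κ ⟧
    κ-small P (m , P⊆ , _) = record
      { to        = λ (_ , p) → proj₁ (P⊆ p)
      ; cong      = λ { {_ , p} {_ , q} x≡y →
          proj₁ (pair-injective (trans (sym (proj₂ (P⊆ p))) (trans x≡y (proj₂ (P⊆ q))))) }
      ; injective = λ { {_ , p} {_ , q} i≡j →
          trans (proj₂ (P⊆ p)) (trans (cong (λ i → pair (i , F.at m i)) i≡j) (sym (proj₂ (P⊆ q)))) }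
      }

    module _ (𝓟 : Family (𝒫 L)) (𝓟⊑ : 𝓟 ⊑ image graph) (𝓟≺θ : ⟪ 𝓟 ⟫ ≺ ⟦ θ ⟧) where
      private
        s = proj₁ (separated (transfer 𝓟) (transfer-⊑ 𝓟) (transfer-≺ 𝓟 𝓟≺θ))
        sep = proj₂ (separated (transfer 𝓟) (transfer-⊑ 𝓟) (transfer-≺ 𝓟 𝓟≺θ))
        open Point s using (point; point-∉; point-cong)

        -- The function whose graph is `P`.
        function : ∃ (member 𝓟) → ∃ (member (transfer 𝓟))
        function (P , p) = F.at (E.index (𝓟⊑ p)) ,
          transfer-∋ 𝓟 (Family.respects 𝓟 (E.at-index (𝓟⊑ p)) p)

        function-cong : ∀ {P Q} → Setoid._≈_ ⟪ 𝓟 ⟫ P Q → ∀ i → proj₁ (function P) i ≡ proj₁ (function Q) i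
        function-cong {P , p} {Q , q} P≐Q i =
          cong (λ m → F.at m i) (E.index-cong (𝓟⊑ p) (𝓟⊑ q) P≐Q)

      choice : ChoiceFunction 𝓟
      choice = record
        { func   = record
          { to   = λ P → pair (point (function P) , proj₁ (function P) (point (function P)))
          ; cong = λ {P} {Q} P≐Q →
              let i≡j = point-cong {function P} {function Q} (function-cong {P} {Q} P≐Q) in
              cong pair (cong₂ _,_ i≡j (trans (function-cong {P} {Q} P≐Q _) (cong (proj₁ (function Q)) i≡j)))
          }
        ; chosen = λ P → proj₂ (E.at-index (𝓟⊑ (proj₂ P))) (point (function P) , refl)
        }

      -- The index chosen for the function f of `P` lies outside s_f, hence outside s_f ∩ s_g for
      -- every g. If the chosen point lay on the graph of g, then f and g would agree at that index.
      discretisation : IsDiscretisation 𝓟 choice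
      discretisation P Q P≉Q x∈Q =
        let (j , eq)       = proj₁ (E.at-index (𝓟⊑ (proj₂ Q))) x∈Q
            (i≡j , fi≡gj) = pair-injective eq
        in
        sep (function P) (function Q)
            (P≉Q ∘ E.index-injective (𝓟⊑ (proj₂ P)) (𝓟⊑ (proj₂ Q)) ∘ F.injective)
            (point (function P)) (point-∉ (function P) ∘ proj₁)
            (trans fi≡gj (cong (proj₁ (function Q)) (sym i≡j)))

    statementA : StatementA
    statementA = image graph , E.bijection , κ-small
      , (λ 𝓟 _ 𝓟≋μ (c , c-injective) → μ⋠Λ 𝓟≋μ (record
           { to = ChoiceFunction.to c
           ; cong = λ {P} {Q} → Func.cong (ChoiceFunction.func c) {P} {Q}
           ; injective = λ {P} {Q} → c-injective {P} {Q} }))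
      , λ 𝓟 𝓟⊑ nonempty 𝓟≺θ → nonempty , choice 𝓟 𝓟⊑ 𝓟≺θ , discretisation 𝓟 𝓟⊑ 𝓟≺θ

theorem4p3 : ExcludedMiddle (lsuc 0ℓ) →
    (μ Λ θ κ : Cardinal) →
    Infinite μ → Infinite Λ → Infinite θ → Infinite κ →
    ⟦ Λ ⟧ ≺ ⟦ μ ⟧ → ⟦ θ ⟧ ≼ ⟦ Λ ⟧ → ⟦ κ ⟧ ≼ ⟦ θ ⟧ →
    (Σ (Family (𝒫 ∣ Λ ∣)) λ 𝓟* →
    ⟪ 𝓟* ⟫ ≋ ⟦ μ ⟧
    × (∀ P → member 𝓟* P → ⟦ Λ ⟧ ↾ P ≼ ⟦ κ ⟧)
    × (∀ 𝓟 → 𝓟 ⊑ 𝓟* → ⟪ 𝓟 ⟫ ≋ ⟦ μ ⟧ → ¬ HasTransversal 𝓟)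
    × (∀ 𝓟 → 𝓟 ⊑ 𝓟* → Nonempty 𝓟 → ⟪ 𝓟 ⟫ ≺ ⟦ θ ⟧ → Discrete 𝓟))
    ⇔
    (Σ (Ideal ∣ κ ∣) λ J → Regular J ×
    (Σ (Family (∣ κ ∣ →-setoid ∣ Λ ∣)) λ 𝓕* →
    ⟪ 𝓕* ⟫ ≋ ⟦ μ ⟧
    × (∀ 𝓕 → 𝓕 ⊑ 𝓕* → ⟪ 𝓕 ⟫ ≺ ⟦ θ ⟧ → ∃ (Separates∩ J 𝓕))
    × (∀ 𝓕 → 𝓕 ⊑ 𝓕* → ⟪ 𝓕 ⟫ ≋ ⟦ μ ⟧ → ¬ ∃ (Separates∩ J 𝓕))
    × (∀ Λ⁺ → Λ⁺ IsSuccessorOf Λ →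
    ∀ 𝓕 → 𝓕 ⊑ 𝓕* → ⟦ Λ⁺ ⟧ ≼ ⟪ 𝓕 ⟫ → ¬ ∃ (Separates∪ J 𝓕))))
theorem4p3 em μ Λ θ κ _ Λ-inf θ-inf κ-inf Λ≺μ θ≼Λ κ≼θ = mk⇔
  (λ (𝓟* , 𝓟*≋μ , κ-small , _ , discrete) → A⇒B.statementB 𝓟* 𝓟*≋μ κ-small discrete)
  (λ (J , _ , 𝓕* , 𝓕*≋μ , separated , _) → B⇒A.statementA J 𝓕* 𝓕*≋μ separated)
  where open Equivalence-of-A-and-B em μ Λ θ κ Λ-inf θ-inf κ-inf Λ≺μ (κ≼θ ⨾ θ≼Λ)
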